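{- Let $k,l\ge 2$ be integers and let $X\subset\mathcal{C}_k$ be an ideal of colorings (with $l$ colors). Then either there exist constants $c$ and $n_0$ such that $|X_n|=c$ for every $n>n_0$, or $|X_n|\ge n-k+2$ for every $n\in\mathbb{N}$.
   Context: $\mathbb{N}=\{1,2,\dots\}$ and $[n]=\{1,2,\dots,n\}$; $\binom{A}{k}$ is the set of $k$-element subsets of $A$. For fixed integers $k,l\ge2$, a coloring is a pair $(n,\chi)$ with $n\in\mathbb{N}$ and $\chi:\binom{[n]}{k}\to[l]$ any map (for $n<k$ the map $\chi$ is the empty map); $\mathcal{C}_k$ is the set of all colorings. For colorings, $(m,\phi)\preceq(n,\chi)$ means that there is an increasing injection $f:[m]\to[n]$ such that $\phi(E)=\chi(f(E))$ for every $E\in\binom{[m]}{k}$. A set $X\subset\mathcal{C}_k$ is an ideal if $K\preceq L\in X$ implies $K\in X$. $X_n$ is the set of those colorings in $X$ that have the vertex set $[n]$. -}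

module Defs where

open import Data.Fin using (Fin; zero; suc; _<_)
open import Data.Fin.Properties using (0≢1+n; suc-injective)
open import Data.Fin.Subset using (Subset; inside; outside; ⊥; ⁅_⁆; _∪_; _∈_; _∉_; ∣_∣)
open import Data.Fin.Subset.Properties
  using (∉⊥; ∣⊥∣≡0; ∪-identityˡ; x∈⁅x⁆; x∈⁅y⁆⇒x≡y; x∈p∪q⁻; x∈p∪q⁺)
open import Data.Nat using (ℕ; suc; NonZero)
open import Data.Product using (Σ; ∃; _×_; _,_; proj₁; proj₂)
open import Data.Sum using (inj₁; inj₂)
open import Data.Vec using ([]; _∷_; here; there)
open import Function using (_∘_)
open import Function.Bundles using (_⇔_; mk⇔; Inverse)
open import Function.Definitions using (Injective)
open import Level using (Level; 0ℓ)
open import Relation.Binary using (Setoid; _Preserves_⟶_)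
import Relation.Binary.Construct.On as On
open import Relation.Binary.PropositionalEquality
  using (_≡_; refl; sym; trans; cong; setoid; _→-setoid_)
open import Relation.Nullary using (contradiction)
open import Relation.Unary using (Pred)

private
  variable
    m n k l : ℕ
    a ℓ : Level

image : (Fin m → Fin n) → Subset m → Subset n
image f []            = ⊥
image f (inside  ∷ E) = ⁅ f zero ⁆ ∪ image (f ∘ suc) E
image f (outside ∷ E) = image (f ∘ suc) E

∈-image⁻ : (f : Fin m → Fin n) (E : Subset m) {j : Fin n} →
           j ∈ image f E → ∃ λ i → i ∈ E × f i ≡ j
∈-image⁻ f []            j∈ = contradiction j∈ ∉⊥
∈-image⁻ f (inside  ∷ E) j∈ with x∈p∪q⁻ ⁅ f zero ⁆ (image (f ∘ suc) E) j∈
... | inj₁ p = zero , here , sym (x∈⁅y⁆⇒x≡y (f zero) p)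
... | inj₂ q with ∈-image⁻ (f ∘ suc) E q
...   | i , i∈E , eq = suc i , there i∈E , eq
∈-image⁻ f (outside ∷ E) j∈ with ∈-image⁻ (f ∘ suc) E j∈
... | i , i∈E , eq = suc i , there i∈E , eq

∈-image⁺ : (f : Fin m → Fin n) {E : Subset m} {i : Fin m} →
           i ∈ E → f i ∈ image f E
∈-image⁺ f {inside  ∷ E} here        = x∈p∪q⁺ (inj₁ (x∈⁅x⁆ (f zero)))
∈-image⁺ f {inside  ∷ E} (there i∈E) = x∈p∪q⁺ (inj₂ (∈-image⁺ (f ∘ suc) i∈E))
∈-image⁺ f {outside ∷ E} (there i∈E) = ∈-image⁺ (f ∘ suc) i∈E

∈-image⇔ : (f : Fin m → Fin n) (E : Subset m) {j : Fin n} →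
           (j ∈ image f E) ⇔ (∃ λ i → i ∈ E × f i ≡ j)
∈-image⇔ f E = mk⇔ (∈-image⁻ f E) λ { (i , i∈E , refl) → ∈-image⁺ f i∈E }

x∉p⇒∣⁅x⁆∪p∣≡1+∣p∣ : (x : Fin n) (p : Subset n) → x ∉ p → ∣ ⁅ x ⁆ ∪ p ∣ ≡ suc ∣ p ∣
x∉p⇒∣⁅x⁆∪p∣≡1+∣p∣ zero    (inside  ∷ p) x∉p = contradiction here x∉p
x∉p⇒∣⁅x⁆∪p∣≡1+∣p∣ zero    (outside ∷ p) x∉p = cong (suc ∘ ∣_∣) (∪-identityˡ p)
x∉p⇒∣⁅x⁆∪p∣≡1+∣p∣ (suc x) (inside  ∷ p) x∉p = cong suc (x∉p⇒∣⁅x⁆∪p∣≡1+∣p∣ x p (x∉p ∘ there))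
x∉p⇒∣⁅x⁆∪p∣≡1+∣p∣ (suc x) (outside ∷ p) x∉p = x∉p⇒∣⁅x⁆∪p∣≡1+∣p∣ x p (x∉p ∘ there)

∣image∣ : (f : Fin m → Fin n) → Injective _≡_ _≡_ f → (E : Subset m) → ∣ image f E ∣ ≡ ∣ E ∣
∣image∣ {n = n} f inj [] = ∣⊥∣≡0 n
∣image∣ f inj (inside ∷ E) =
  trans (x∉p⇒∣⁅x⁆∪p∣≡1+∣p∣ (f zero) (image (f ∘ suc) E) f0∉)
        (cong suc (∣image∣ (f ∘ suc) (suc-injective ∘ inj) E))
  where
  f0∉ : f zero ∉ image (f ∘ suc) E
  f0∉ f0∈ with ∈-image⁻ (f ∘ suc) E f0∈
  ... | i , _ , eq = 0≢1+n (inj (sym eq))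
∣image∣ f inj (outside ∷ E) = ∣image∣ (f ∘ suc) (suc-injective ∘ inj) E

KSubset : ℕ → ℕ → Set
KSubset k n = Σ (Subset n) λ E → ∣ E ∣ ≡ k

imageₖ : (f : Fin m → Fin n) → Injective _≡_ _≡_ f → KSubset k m → KSubset k n
imageₖ f inj (E , ∣E∣≡k) = image f E , trans (∣image∣ f inj E) ∣E∣≡k

-- The vertex set {1,…,n} is represented by Fin n with its usual order, n ≥ 1.
record Coloring (k l : ℕ) : Set where
  constructor coloring
  field
    size           : ℕ
    .{{size≢0}}    : NonZero size
    color          : KSubset k size → Fin l

open Coloring public

record _⪯_ {k l : ℕ} (K L : Coloring k l) : Set where
  field
    embed      : Fin (size K) → Fin (size L)
    injective  : Injective _≡_ _≡_ embed
    increasing : embed Preserves _<_ ⟶ _<_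
    preserves  : ∀ E → color K E ≡ color L (imageₖ embed injective E)

IsIdeal : Pred (Coloring k l) ℓ → Set ℓ
IsIdeal X = ∀ {K L} → K ⪯ L → X L → X K

-- The members of X on n vertices. Two of them are identified when they give
-- every k-subset the same color; an ideal cannot distinguish such colorings,
-- since they embed in each other by the identity.
Section : Pred (Coloring k l) ℓ → (n : ℕ) .{{_ : NonZero n}} → Setoid ℓ 0ℓ
Section {k} {l} X n =
  On.setoid {B = Σ (KSubset k n → Fin l) λ χ → X (coloring n χ)}
            (KSubset k n →-setoid Fin l) proj₁

HasCardinality : Setoid a ℓ → ℕ → Set _
HasCardinality S c = Inverse (setoid (Fin c)) S

{-# OPTIONS --safe #-}

-- Suppose |X_N| ≤ N - k + 1 for some N ≥ k.  Call consecutive vertices i, i+1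
-- of a coloring twins if exchanging them in an edge that contains just one of
-- them never changes its color.  If a coloring in X had, far from both ends, a
-- pair that are not twins, then Ramsey's theorem on the two sides of the pair
-- would give long blocks L and R and a few vertices between them such that the
-- color of an edge depends only on the vertices between and on how many vertices
-- the edge takes from L and from R; such a coloring has N - k + 2 different
-- restrictions to N vertices.  So there is a D such that all consecutive
-- vertices at distance at least D from both ends are twins.  In a run of more
-- than k such vertices any one can be deleted without loss of information, hence
-- |X_{n+1}| ≤ |X_n| for large n, and |X_n| is eventually constant.
module Submission where

open import Defs
open import Axiom.ExcludedMiddle using (ExcludedMiddle)
open import Data.Nat using (ℕ; _+_; _≤_; _<_; NonZero)
open import Data.Product using (∃; _×_)
open import Data.Sum using (_⊎_)
open import Relation.Unary using (Pred)
open import Data.Fin as Fin using (Fin; zero; suc; toℕ; cast)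
import Data.Fin.Properties as Fin
open import Data.Fin.Subset as Subset using (Subset; inside; outside; ⁅_⁆; _∪_; ∣_∣)
import Data.Fin.Subset.Properties as Subset
open import Data.List using (List; []; _∷_; _++_; length; map; take; drop; allFin; tabulate; foldr; lookup)
open import Data.List.Membership.Propositional using (_∈_)
open import Data.List.Membership.Propositional.Properties using (∈-allFin; ∈-lookup)
open import Data.List.Properties
  using (length-++; length-take; length-drop; length-map; length-tabulate; ++-assoc; ++-identityʳ; take++drop≡id)
open import Data.List.Relation.Binary.Sublist.Propositional
  using (_⊆_; []; _∷_; _∷ʳ_; ⊆-refl; ⊆-trans; ⊆-reflexive; minimum)
open import Data.List.Relation.Binary.Sublist.Propositional.Properties
  using (++⁺; ++⁺ˡ; ++⁺ʳ; map⁺; take⁺; take-⊆; All-resp-⊆)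
open import Data.List.Relation.Unary.All as All using (All; []; _∷_)
open import Data.List.Relation.Unary.AllPairs using (AllPairs; []; _∷_)
import Data.List.Relation.Unary.AllPairs.Properties as AllPairs
open import Data.List.Relation.Unary.Any using (here; there)
open import Data.Nat using (zero; suc; _*_; _∸_; z≤n; s≤s; _≤?_; _≟_)
open import Data.Nat.Induction using (<-wellFounded)
open import Data.Nat.Properties hiding (_≟_; _≤?_)
open import Data.Nat.Solver using (module +-*-Solver)
open import Data.Product using (∃₂; _,_; proj₁; proj₂)
open import Data.Sum using (inj₁; inj₂)
open import Data.Unit using (⊤; tt)
open import Data.Vec using ([]; _∷_)
open import Function using (_∘_; id)
open import Function.Bundles using (Inverse)
import Function.Construct.Identity as Identity
open import Function.Definitions using (Injective)
open import Induction.WellFounded using (Acc; acc)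
open import Level using (Level; Lift; lift; lower)
open import Relation.Binary using (Setoid; _Preserves_⟶_; tri<; tri≈; tri>)
open import Relation.Binary.PropositionalEquality
open import Relation.Nullary using (¬_; Dec; yes; no; contradiction)
open import Relation.Nullary.Decidable using (map′)

private
  variable
    a ℓ : Level
    A B : Set
    k l m n : ℕ
    u v w y z : List A

-- Splitting sublists

⊆-++⁻ : ∀ (xs : List A) {ys u} → u ⊆ xs ++ ys → ∃₂ λ v w → u ≡ v ++ w × v ⊆ xs × w ⊆ ys
⊆-++⁻ []       u⊆ = [] , _ , refl , [] , u⊆
⊆-++⁻ (x ∷ xs) (.x ∷ʳ u⊆) with ⊆-++⁻ xs u⊆
... | v , w , eq , v⊆ , w⊆ = v , w , eq , x ∷ʳ v⊆ , w⊆
⊆-++⁻ (x ∷ xs) (refl ∷ u⊆) with ⊆-++⁻ xs u⊆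
... | v , w , eq , v⊆ , w⊆ = x ∷ v , w , cong (x ∷_) eq , refl ∷ v⊆ , w⊆

length-take-≤ : ∀ r (xs : List A) → r ≤ length xs → length (take r xs) ≡ r
length-take-≤ r xs r≤ = trans (length-take r xs) (m≤n⇒m⊓n≡m r≤)

-- Ramsey's theorem for sublists

partition-⊆ : {P : B → Set} → (∀ b → Dec (P b)) → (xs : List B) →
              ∃₂ λ ys zs → ys ⊆ xs × All P ys × zs ⊆ xs × All (¬_ ∘ P) zs ×
                           length xs ≡ length ys + length zs
partition-⊆ P? []       = [] , [] , [] , [] , [] , [] , refl
partition-⊆ P? (x ∷ xs) with P? x | partition-⊆ P? xs
... | yes p | ys , zs , ys⊆ , pys , zs⊆ , pzs , eq =
  x ∷ ys , zs , refl ∷ ys⊆ , p ∷ pys , x ∷ʳ zs⊆ , pzs , cong suc eq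
... | no ¬p | ys , zs , ys⊆ , pys , zs⊆ , pzs , eq =
  ys , x ∷ zs , x ∷ʳ ys⊆ , pys , refl ∷ zs⊆ , ¬p ∷ pzs ,
  trans (cong suc eq) (sym (+-suc (length ys) (length zs)))

-- `cs` lists the colors that can still occur. If `col` takes fewer than `r` entries, dropping them
-- costs less than `r` of the length, and the rest has one color fewer available.
pigeonhole-⊆ : (f : B → Fin l) (cs : List (Fin l)) (r : ℕ) (xs : List B) →
               All (λ b → f b ∈ cs) xs → length cs * r < length xs →
               ∃₂ λ col ys → ys ⊆ xs × length ys ≡ r × All (λ b → f b ≡ col) ys
pigeonhole-⊆ f []         r (x ∷ xs) (() ∷ _) _
pigeonhole-⊆ f (col ∷ cs) r xs f∈ big with partition-⊆ (λ b → f b Fin.≟ col) xs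
... | ys , zs , ys⊆ , eqs , zs⊆ , neqs , len with r ≤? length ys
...   | yes r≤ = col , take r ys , ⊆-trans (take-⊆ r ys) ys⊆ , length-take-≤ r ys r≤ ,
                 All-resp-⊆ (take-⊆ r ys) eqs
...   | no  r≰ with pigeonhole-⊆ f cs r zs
                      (All.zipWith inCs (All-resp-⊆ zs⊆ f∈ , neqs))
                      (+-cancelˡ-< (length ys) _ _ (≤-<-trans (+-monoˡ-≤ (length cs * r) (<⇒≤ (≰⇒> r≰))) (subst (r + length cs * r <_) len big)))
  where
  inCs : ∀ {b} → f b ∈ col ∷ cs × ¬ f b ≡ col → f b ∈ cs
  inCs (here eq , neq) = contradiction eq neq
  inCs (there i , _)   = i
...     | col′ , ws , ws⊆ , lws , mono = col′ , ws , ⊆-trans ws⊆ zs⊆ , lws , mono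

Hom : ℕ → (List A → Fin l) → List A → Set
Hom {l = l} k c ys = ∃ λ (col : Fin l) → ∀ {u} → u ⊆ ys → length u ≡ k → c u ≡ col

-- End-homogeneous lists: the stored color belongs to all edges of `suc k` vertices that start at
-- the vertex, so an edge's color is known from its first vertex.
EndHom : ℕ → (List A → Fin l) → List (A × Fin l) → Set
EndHom k c []               = ⊤
EndHom k c ((y , col) ∷ ys) =
  (∀ {u} → u ⊆ map proj₁ ys → length u ≡ k → c (y ∷ u) ≡ col) × EndHom k c ys

EndHom⇒Hom : ∀ {k} (c : List A → Fin l) {col} {xs ys} → EndHom k c xs → ys ⊆ xs →
             All (λ p → proj₂ p ≡ col) ys →
             ∀ {u} → u ⊆ map proj₁ ys → length u ≡ suc k → c u ≡ col
EndHom⇒Hom c h       []           _          []          ()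
EndHom⇒Hom c (_ , h) (_ ∷ʳ ys⊆)   mono       u⊆          len = EndHom⇒Hom c h ys⊆ mono u⊆ len
EndHom⇒Hom c (_ , h) (refl ∷ ys⊆) (_ ∷ mono) (_ ∷ʳ u⊆)   len = EndHom⇒Hom c h ys⊆ mono u⊆ len
EndHom⇒Hom c (e , _) (refl ∷ ys⊆) (eq ∷ _)   (refl ∷ u⊆) len =
  trans (e (⊆-trans u⊆ (map⁺ proj₁ ys⊆)) (suc-injective len)) eq

ramsey#    : (l k r : ℕ) → ℕ
ramseyEnd# : (l k t : ℕ) → ℕ
ramsey# l zero    r       = r
ramsey# l (suc k) r       = ramseyEnd# l k (suc (l * r))
ramseyEnd# l k    zero    = 0
ramseyEnd# l k    (suc t) = suc (ramsey# l k (ramseyEnd# l k t))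

-- The two proofs alternate. For edges of size `suc k`, an end-homogeneous list of `suc (l * r)`
-- vertices has `r` with the same stored color. Such a list is built by keeping the first vertex `x`
-- and applying the theorem for size `k` to the coloring `c ∘ (x ∷_)` of what follows.
ramsey    : ∀ k r (c : List A → Fin l) xs → ramsey# l k r ≤ length xs →
            ∃ λ ys → ys ⊆ xs × length ys ≡ r × Hom k c ys
ramseyEnd : ∀ k t (c : List A → Fin l) xs → ramseyEnd# l k t ≤ length xs →
            ∃ λ ys → map proj₁ ys ⊆ xs × length ys ≡ t × EndHom k c ys

ramsey zero r c xs big =
  take r xs , take-⊆ r xs , length-take-≤ r xs big , c [] , λ { {[]} _ _ → refl }
ramsey {l = l} (suc k) r c xs big with ramseyEnd k (suc (l * r)) c xs big
... | ys , ys⊆ , len , h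
    with pigeonhole-⊆ proj₂ (allFin l) r ys (All.universal (λ p → ∈-allFin (proj₂ p)) ys)
           (subst (_< length ys) (cong (_* r) (sym (length-tabulate {n = l} (λ i → i)))) (≤-reflexive (sym len)))
...   | col , zs , zs⊆ , lzs , mono =
  map proj₁ zs , ⊆-trans (map⁺ proj₁ zs⊆) ys⊆ , trans (length-map proj₁ zs) lzs ,
  col , EndHom⇒Hom c h zs⊆ mono

ramseyEnd k zero    c xs       big = [] , minimum xs , refl , tt
ramseyEnd {l = l} k (suc t) c (x ∷ xs) (s≤s big)
  with ramsey k (ramseyEnd# l k t) (c ∘ (x ∷_)) xs big
... | ys , ys⊆ , len , col , hom with ramseyEnd k t c ys (≤-reflexive (sym len))
...   | zs , zs⊆ , lzs , h =
  (x , col) ∷ zs , refl ∷ ⊆-trans zs⊆ ys⊆ , cong suc lzs ,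
  (λ u⊆ → hom (⊆-trans u⊆ zs⊆)) , h

-- All sizes up to `k` are treated at once because an edge may have any number of its vertices in a
-- given block.
Hom≤ : ℕ → (List A → Fin l) → List A → Set
Hom≤ k c ys = ∀ {u v} → u ⊆ ys → v ⊆ ys → length u ≡ length v → length u ≤ k → c u ≡ c v

ramsey≤# : (l k r : ℕ) → ℕ
ramsey≤# l zero    r = ramsey# l 0 r
ramsey≤# l (suc k) r = ramsey≤# l k (ramsey# l (suc k) r)

ramsey≤ : ∀ k r (c : List A → Fin l) xs → ramsey≤# l k r ≤ length xs →
          ∃ λ ys → ys ⊆ xs × length ys ≡ r × Hom≤ k c ys
ramsey≤ zero    r c xs big =
  take r xs , take-⊆ r xs , length-take-≤ r xs big , λ { {[]} {[]} _ _ _ _ → refl }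
ramsey≤ {l = l} (suc k) r c xs big with ramsey≤ k (ramsey# l (suc k) r) c xs big
... | ys , ys⊆ , lys , hom with ramsey (suc k) r c ys (≤-reflexive (sym lys))
...   | zs , zs⊆ , lzs , col , mono = zs , ⊆-trans zs⊆ ys⊆ , lzs , hom′
  where
  hom′ : Hom≤ (suc k) c zs
  hom′ u⊆ v⊆ eq le with m≤n⇒m<n∨m≡n le
  ... | inj₁ (s≤s le′) = hom (⊆-trans u⊆ zs⊆) (⊆-trans v⊆ zs⊆) eq le′
  ... | inj₂ eq′       = trans (mono u⊆ eq′) (sym (mono v⊆ (trans (sym eq) eq′)))

ramsey*# : (l k q r : ℕ) → ℕ
ramsey*# l k zero    r = ramsey≤# l k r
ramsey*# l k (suc q) r = ramsey*# l k q (ramsey*# l k q r)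

-- For each `z` in `zs` the list is thinned twice: for the `w` that omit `z` and for those that
-- contain it. The required length involves only the bound `q`, so it can be fixed before `zs` is
-- known.
ramsey* : ∀ k q r (F : List A → List A → Fin l) zs → length zs ≤ q →
          ∀ xs → ramsey*# l k q r ≤ length xs →
          ∃ λ ys → ys ⊆ xs × length ys ≡ r × (∀ {w} → w ⊆ zs → Hom≤ k (F w) ys)
ramsey* k zero r F [] _ xs big with ramsey≤ k r (F []) xs big
... | ys , ys⊆ , len , hom = ys , ys⊆ , len , λ { [] → hom }
-- `zs` is used up before `q`; the second round merely brings the length down to `r`.
ramsey* {l = l} k (suc q) r F [] _ xs big with ramsey* k q (ramsey*# l k q r) F [] z≤n xs big
... | ys , ys⊆ , lys , hom with ramsey* k q r F [] z≤n ys (≤-reflexive (sym lys))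
...   | ws , ws⊆ , lws , hom′ = ws , ⊆-trans ws⊆ ys⊆ , lws , hom′
ramsey* {l = l} k (suc q) r F (z ∷ zs) (s≤s le) xs big
  with ramsey* k q (ramsey*# l k q r) F zs le xs big
... | ys , ys⊆ , lys , hom with ramsey* k q r (F ∘ (z ∷_)) zs le ys (≤-reflexive (sym lys))
...   | ws , ws⊆ , lws , hom′ = ws , ⊆-trans ws⊆ ys⊆ , lws ,
  λ { (_ ∷ʳ w⊆)   u⊆ v⊆ → hom w⊆ (⊆-trans u⊆ ws⊆) (⊆-trans v⊆ ws⊆)
    ; (refl ∷ w⊆) → hom′ w⊆ }

-- Restrictions that some edge tells apart

-- u and v are selected from y and z at the same positions.
data Aligned {A : Set} : (u v y z : List A) → Set where
  []   : Aligned [] [] [] []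
  skip : ∀ {u v y z} a b → Aligned u v y z → Aligned u v (a ∷ y) (b ∷ z)
  keep : ∀ {u v y z} a b → Aligned u v y z → Aligned (a ∷ u) (b ∷ v) (a ∷ y) (b ∷ z)

aligned-refl : u ⊆ z → Aligned u u z z
aligned-refl []          = []
aligned-refl (a ∷ʳ u⊆)   = skip a a (aligned-refl u⊆)
aligned-refl (refl ∷ u⊆) = keep _ _ (aligned-refl u⊆)

aligned-++ : ∀ {u v y z u′ v′ y′ z′ : List A} → Aligned u v y z → Aligned u′ v′ y′ z′ →
             Aligned (u ++ u′) (v ++ v′) (y ++ y′) (z ++ z′)
aligned-++ []           q = q
aligned-++ (skip a b p) q = skip a b (aligned-++ p q)
aligned-++ (keep a b p) q = keep a b (aligned-++ p q)

aligned-length : ∀ {u v y z : List A} → Aligned u v y z → length u ≡ length v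
aligned-length []           = refl
aligned-length (skip a b p) = aligned-length p
aligned-length (keep a b p) = cong suc (aligned-length p)

align : (y : List A) → length y ≡ length z → v ⊆ z → ∃ λ u → u ⊆ y × Aligned u v y z
align []      _  []          = [] , [] , []
align (a ∷ y) eq (b ∷ʳ v⊆) with align y (suc-injective eq) v⊆
... | u , u⊆ , al = u , a ∷ʳ u⊆ , skip a b al
align (a ∷ y) eq (refl ∷ v⊆) with align y (suc-injective eq) v⊆
... | u , u⊆ , al = a ∷ u , refl ∷ u⊆ , keep a _ al

Distinct : (List A → Fin l) → ℕ → (y z : List A) → Set
Distinct c k y z = ∃₂ λ u v → Aligned u v y z × length u ≡ k × c u ≢ c v

-- Once `c` comes from a coloring in the ideal, this provides `s` different members of the ideal on
-- `m` vertices.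
Separated : (c : List A → Fin l) (k m s : ℕ) → List A → Set
Separated {A} c k m s xs = ∃ λ (z : Fin s → List A) →
  (∀ i → z i ⊆ xs × length (z i) ≡ m) × (∀ {i j} → i Fin.< j → Distinct c k (z i) (z j))

constant-or-not : ∀ (c : List A → Fin l) k xs q →
  (∀ {u} → u ⊆ xs → length u ≡ k → c u ≡ q) ⊎ (∃ λ u → u ⊆ xs × length u ≡ k × c u ≢ q)
constant-or-not c zero xs q with c [] Fin.≟ q
... | yes eq = inj₁ λ { {[]} _ _ → eq }
... | no neq = inj₂ ([] , minimum xs , refl , neq)
constant-or-not c (suc k) [] q = inj₁ λ { [] () }
constant-or-not c (suc k) (x ∷ xs) q
  with constant-or-not c (suc k) xs q | constant-or-not (c ∘ (x ∷_)) k xs q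
... | inj₂ (u , u⊆ , len , neq) | _ = inj₂ (u , x ∷ʳ u⊆ , len , neq)
... | inj₁ _ | inj₂ (u , u⊆ , len , neq) = inj₂ (x ∷ u , refl ∷ u⊆ , cong suc len , neq)
... | inj₁ h | inj₁ h′ =
  inj₁ λ { (_ ∷ʳ u⊆) len → h u⊆ len ; (refl ∷ u⊆) len → h′ u⊆ (suc-injective len) }

-- A discrete intermediate value argument. With `g j` the color of an edge having `j` vertices in
-- `L` and the others in `R`, it supplies the neighboring counts from which `separate-step` starts.
jump : (g : ℕ → Fin l) (p d : ℕ) → g p ≢ g (d + p) → ∃ λ j → j < d + p × g j ≢ g (suc j)
jump g p zero    neq = contradiction refl neq
jump g p (suc d) neq with g p Fin.≟ g (d + p)
... | yes eq = d + p , ≤-refl , λ eq′ → neq (trans eq eq′)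
... | no neq′ with jump g p d neq′
...   | j , j< , neq″ = j , m<n⇒m<1+n j< , neq″

take-split : ∀ {a b} (xs : List A) → a < b → b ≤ length xs →
             ∃₂ λ y ys → take b xs ≡ take a xs ++ y ∷ ys
take-split {a = zero}  (x ∷ xs) (s≤s _)   _       = x , _ , refl
take-split {a = suc a} (x ∷ xs) (s≤s a<b) (s≤s le) with take-split xs a<b le
... | y , ys , eq = y , ys , cong (x ∷_) eq

Blockwise : (List A → Fin l) → ℕ → (L M R : List A) → Set
Blockwise c k L M R = ∀ {u u′ t v v′} → u ⊆ L → u′ ⊆ L → t ⊆ M → v ⊆ R → v′ ⊆ R →
  length u ≡ length u′ → length v ≡ length v′ → length (u ++ t ++ v) ≡ k →
  c (u ++ t ++ v) ≡ c (u′ ++ t ++ v′)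

module _ {A : Set} {l : ℕ} where

  -- The restrictions take a vertices from L and k + e - a from R, for j ≤ a ≤ j + e + 1.
  -- For a < b an edge on the first j positions, position a and the last k - j - 1
  -- positions takes j vertices from L in the first and j + 1 in the second.
  separate-step : ∀ {k e j} (c : List A → Fin l) (L R : List A) →
    k + e ≤ length L → k + e ≤ length R → Blockwise c k L [] R →
    j < k → c (take j L ++ take (k ∸ j) R) ≢ c (take (suc j) L ++ take (k ∸ suc j) R) →
    Separated c k (k + e) (2 + e) (L ++ R)
  separate-step {k} {e} {j} c L R L≥ R≥ block j<k neq =
    fam , (λ t → ++⁺ (take-⊆ (j + toℕ t) L) (take-⊆ (k + e ∸ (j + toℕ t)) R) , len t) , distinct
    where
    fam : Fin (2 + e) → List A
    fam t = take (j + toℕ t) L ++ take (k + e ∸ (j + toℕ t)) R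
    bound : ∀ t → j + toℕ t ≤ suc j + e
    bound t = subst (j + toℕ t ≤_) (+-suc j e) (+-monoʳ-≤ j (Fin.toℕ≤pred[n] t))
    bound′ : ∀ t → j + toℕ t ≤ k + e
    bound′ t = ≤-trans (bound t) (+-monoˡ-≤ e j<k)
    len : ∀ t → length (fam t) ≡ k + e
    len t = trans (length-++ (take (j + toℕ t) L))
      (trans (cong₂ _+_ (length-take-≤ _ L (≤-trans (bound′ t) L≥))
                        (length-take-≤ (k + e ∸ (j + toℕ t)) R (≤-trans (m∸n≤m (k + e) (j + toℕ t)) R≥)))
             (m+[n∸m]≡n (bound′ t)))
    -- Even at the largest `a = j + 1 + e` the `k + e - a` vertices from `R` suffice for the
    -- `k - j - 1` that the edge takes there.
    r≤ : ∀ t → k ∸ suc j ≤ k + e ∸ (j + toℕ t)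
    r≤ t = subst (_≤ k + e ∸ (j + toℕ t))
             (trans (cong₂ _∸_ (+-comm k e) (+-comm (suc j) e)) ([m+n]∸[m+o]≡n∸o e k (suc j)))
             (∸-monoʳ-≤ (k + e) (bound t))
    k≤L : k ≤ length L
    k≤L = ≤-trans (m≤m+n k e) L≥
    k≤R : k ≤ length R
    k≤R = ≤-trans (m≤m+n k e) R≥
    r = k ∸ suc j
    sucr : suc r ≡ k ∸ j
    sucr = sym (+-∸-assoc 1 j<k)
    lenj : length (take j L) ≡ j
    lenj = length-take-≤ j L (≤-trans (<⇒≤ j<k) k≤L)
    lenr : length (take r R) ≡ r
    lenr = length-take-≤ r R (≤-trans (m∸n≤m k (suc j)) k≤R)
    regroup : ∀ {s t y ys} → take (j + toℕ t) L ≡ take (j + toℕ s) L ++ y ∷ ys →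
              fam t ≡ take (j + toℕ s) L ++ (y ∷ ys) ++ take (k + e ∸ (j + toℕ t)) R
    regroup {s} {t} {y} {ys} eq = trans (cong (_++ _) eq) (++-assoc (take (j + toℕ s) L) (y ∷ ys) _)
    distinct : ∀ {s t} → s Fin.< t → Distinct c k (fam s) (fam t)
    distinct {s} {t} s<t
      -- `y` stands at the position where `fam t` is still in `L` while `fam s` has already passed
      -- to `R`.
      with take-split L (+-monoʳ-< j s<t) (≤-trans (bound′ t) L≥)
    ... | y , ys , eq
      with align {z = (y ∷ ys) ++ take (k + e ∸ (j + toℕ t)) R} {v = y ∷ take r R}
                 (take (k + e ∸ (j + toℕ s)) R)
                 (+-cancelˡ-≡ (length (take (j + toℕ s) L)) _ _
                   (trans (sym (length-++ (take (j + toℕ s) L)))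
                     (trans (len s) (trans (sym (len t))
                       (trans (cong length (regroup {s} {t} eq)) (length-++ (take (j + toℕ s) L)))))))
                 (refl ∷ ++⁺ˡ ys (take⁺ (r≤ t)))
    ...   | w , w⊆ , al =
      take j L ++ w , take j L ++ y ∷ take r R ,
      subst (Aligned _ _ (fam s)) (sym (regroup {s} {t} eq))
        (aligned-++ (aligned-refl (take⁺ (m≤m+n j (toℕ s)))) al) ,
      lenu ,
      λ eq′ → neq (trans (sym left) (trans eq′ right))
      where
      lenw : length w ≡ suc r
      lenw = trans (aligned-length al) (cong suc lenr)
      lenu : length (take j L ++ w) ≡ k
      lenu = trans (length-++ (take j L)) (trans (cong₂ _+_ lenj (trans lenw sucr)) (m+[n∸m]≡n (<⇒≤ j<k)))
      left : c (take j L ++ w) ≡ c (take j L ++ take (k ∸ j) R)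
      left = block {t = []} (take-⊆ j L) (take-⊆ j L) [] (⊆-trans w⊆ (take-⊆ _ R)) (take-⊆ _ R)
               refl (trans lenw (trans sucr (sym (length-take-≤ _ R (≤-trans (m∸n≤m k j) k≤R))))) lenu
      y⊆ : take j L ++ y ∷ [] ⊆ L
      y⊆ = ⊆-trans (++⁺ (take⁺ (m≤m+n j (toℕ s))) (refl ∷ minimum ys))
                   (⊆-trans (⊆-reflexive (sym eq)) (take-⊆ _ L))
      leny : length (take j L ++ y ∷ []) ≡ suc j
      leny = trans (length-++ (take j L)) (trans (cong (_+ 1) lenj) (+-comm j 1))
      right : c (take j L ++ y ∷ take r R) ≡ c (take (suc j) L ++ take r R)
      right = trans (cong c (sym (++-assoc (take j L) (y ∷ []) (take r R))))
        (block {t = []} y⊆ (take-⊆ (suc j) L) [] (take-⊆ r R) (take-⊆ r R)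
           (trans leny (sym (length-take-≤ (suc j) L (≤-trans j<k k≤L)))) refl
           (trans (length-++ (take j L ++ y ∷ []))
             (trans (cong₂ _+_ leny lenr) (m+[n∸m]≡n j<k))))

  -- One restriction lies in L; the others consist of a vertices from L, then x ∷ t,
  -- then vertices from R, for j ≤ a ≤ j + e with j = length u. For a < b, an edge like
  -- u ++ x ∷ t ++ v in the second that avoids position a misses x in the first.
  separate-pivot : ∀ {k e x u t v} (c : List A → Fin l) (L M R : List A) →
    k + e ≤ length L → k + e ≤ length R → Blockwise c k L (x ∷ M) R →
    (q : Fin l) → (∀ {w} → w ⊆ L ++ M ++ R → length w ≡ k → c w ≡ q) →
    u ⊆ L → t ⊆ M → v ⊆ R → length (u ++ x ∷ t ++ v) ≡ k → c (u ++ x ∷ t ++ v) ≢ q →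
    Separated c k (k + e) (2 + e) (L ++ x ∷ M ++ R)
  separate-pivot {k} {e} {x} {u} {t} {v} c L M R L≥ R≥ block q const u⊆ t⊆ v⊆ len-uv neq =
    fam , (λ s → fam⊆ s , len s) , distinct
    where
    j = length u
    r = length v
    k≡ : j + suc (length t + r) ≡ k
    k≡ = trans (cong (λ n → j + suc n) (sym (length-++ t))) (trans (sym (length-++ u)) len-uv)
    j≤k : j ≤ k
    j≤k = subst (j ≤_) k≡ (m≤m+n j _)
    r≤k : r ≤ k
    r≤k = subst (r ≤_) k≡ (≤-trans (m≤n+m r (length t)) (≤-trans (n≤1+n _) (m≤n+m _ j)))
    k≤L : k ≤ length L
    k≤L = ≤-trans (m≤m+n k e) L≥
    k≤R : k ≤ length R
    k≤R = ≤-trans (m≤m+n k e) R≥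
    tail : ℕ → List A
    tail s = t ++ take (r + (e ∸ s)) R
    fam : Fin (2 + e) → List A
    fam zero    = take (k + e) L
    fam (suc s) = take (j + toℕ s) L ++ x ∷ tail (toℕ s)
    fam⊆ : ∀ s → fam s ⊆ L ++ x ∷ M ++ R
    fam⊆ zero    = ++⁺ʳ _ (take-⊆ _ L)
    fam⊆ (suc s) = ++⁺ (take-⊆ _ L) (refl ∷ ++⁺ t⊆ (take-⊆ _ R))
    s≤e : (s : Fin (suc e)) → toℕ s ≤ e
    s≤e = Fin.toℕ≤pred[n]
    a≤L : (s : Fin (suc e)) → j + toℕ s ≤ length L
    a≤L s = ≤-trans (+-mono-≤ j≤k (s≤e s)) L≥
    len : ∀ s → length (fam s) ≡ k + e
    len zero    = length-take-≤ _ L L≥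
    len (suc s) = begin
      length (take (j + toℕ s) L ++ x ∷ tail (toℕ s))
        ≡⟨ length-++ (take (j + toℕ s) L) ⟩
      length (take (j + toℕ s) L) + suc (length (tail (toℕ s)))
        ≡⟨ cong₂ (λ m n → m + suc n) (length-take-≤ _ L (a≤L s)) (trans (length-++ t)
             (cong (length t +_) (length-take-≤ _ R (≤-trans (+-mono-≤ r≤k (m∸n≤m e (toℕ s))) R≥)))) ⟩
      j + toℕ s + suc (length t + (r + (e ∸ toℕ s)))
        ≡⟨ rearrange j (toℕ s) (length t) r (e ∸ toℕ s) ⟩
      (j + suc (length t + r)) + (toℕ s + (e ∸ toℕ s))
        ≡⟨ cong₂ _+_ k≡ (m+[n∸m]≡n (s≤e s)) ⟩
      k + e ∎
      where
      open ≡-Reasoning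
      open +-*-Solver
      rearrange : ∀ a b c d f → a + b + suc (c + (d + f)) ≡ (a + suc (c + d)) + (b + f)
      rearrange = solve 5 (λ a b c d f → a :+ b :+ (con 1 :+ (c :+ (d :+ f))) :=
                                         (a :+ (con 1 :+ (c :+ d))) :+ (b :+ f)) refl
    -- The edge through `x` whose color is not `q`, pushed to the start of `L` and of `R`: every
    -- `fam (suc s)` contains it there, and `block` preserves the color.
    sel = take j L ++ x ∷ t ++ take r R
    lenj : length (take j L) ≡ j
    lenj = length-take-≤ j L (≤-trans j≤k k≤L)
    lensel : length sel ≡ k
    lensel = trans (length-++ (take j L))
      (trans (cong₂ (λ m n → m + suc n) lenj
               (trans (length-++ t) (cong (length t +_) (length-take-≤ r R (≤-trans r≤k k≤R))))) k≡)
    sel≢ : c sel ≢ q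
    sel≢ eq = neq (trans (block u⊆ (take-⊆ j L) (refl ∷ t⊆) v⊆ (take-⊆ r R)
      (sym lenj) (sym (length-take-≤ r R (≤-trans r≤k k≤R))) len-uv) eq)
    tail⊆ : ∀ s → x ∷ t ++ take r R ⊆ x ∷ tail s
    tail⊆ s = refl ∷ ++⁺ (⊆-refl {x = t}) (take⁺ (m≤m+n r (e ∸ s)))
    regroup : ∀ {s s′ y ys} → take (j + toℕ s′) L ≡ take (j + toℕ s) L ++ y ∷ ys →
              fam (suc s′) ≡ take (j + toℕ s) L ++ y ∷ (ys ++ x ∷ tail (toℕ s′))
    regroup {s} {s′} {y} {ys} eq =
      trans (cong (_++ _) eq) (++-assoc (take (j + toℕ s) L) (y ∷ ys) _)
    distinct : ∀ {s s′} → s Fin.< s′ → Distinct c k (fam s) (fam s′)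
    -- `fam zero` avoids `x`, so all its edges have color `q`, unlike `sel`.
    distinct {zero} {suc s} _
      with align (take (k + e) L) (trans (len zero) (sym (len (suc s))))
             (++⁺ (take⁺ (m≤m+n j (toℕ s))) (tail⊆ (toℕ s)))
    ... | w , w⊆ , al = w , sel , al , trans (aligned-length al) lensel ,
      λ eq → sel≢ (trans (sym eq) (const (++⁺ʳ _ (⊆-trans w⊆ (take-⊆ _ L)))
                                         (trans (aligned-length al) lensel)))
    distinct {suc s} {suc s′} (s≤s s<s′)
      with take-split L (+-monoʳ-< j s<s′) (a≤L s′)
    ... | y , ys , eq
      with align {z = ys ++ x ∷ tail (toℕ s′)} {v = x ∷ t ++ take r R} (tail (toℕ s))
             (suc-injective (+-cancelˡ-≡ (length (take (j + toℕ s) L)) _ _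
               (trans (sym (length-++ (take (j + toℕ s) L)))
                 (trans (len (suc s)) (trans (sym (len (suc s′)))
                   (trans (cong length (regroup {s} {s′} eq)) (length-++ (take (j + toℕ s) L))))))))
             (++⁺ˡ ys (tail⊆ (toℕ s′)))
    ...   | w , w⊆ , al = take j L ++ w , sel , al′ , lenw ,
      λ eq′ → sel≢ (trans (sym eq′) (const
        (++⁺ (take-⊆ j L) (⊆-trans w⊆ (++⁺ t⊆ (take-⊆ _ R)))) lenw))
      where
      al′ : Aligned (take j L ++ w) sel (fam (suc s)) (fam (suc s′))
      al′ = subst (Aligned _ _ (fam (suc s))) (sym (regroup {s} {s′} eq))
              (aligned-++ (aligned-refl (take⁺ (m≤m+n j (toℕ s)))) (skip x y al))
      lenw : length (take j L ++ w) ≡ k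
      lenw = trans (aligned-length al′) lensel

  separated-⊆ : ∀ {c : List A → Fin l} {k m s xs ys} → xs ⊆ ys →
                Separated c k m s xs → Separated c k m s ys
  separated-⊆ xs⊆ys (z , h , d) =
    z , (λ i → ⊆-trans (proj₁ (h i)) xs⊆ys , proj₂ (h i)) , d

  -- By induction on `M`. If the edges avoiding the first vertex `x` of `M` do not all have the
  -- color of `take k L`, drop `x`; if they do, `u` must contain `x`, and `x` serves as the pivot.
  -- With `M` empty only the counts in `L` and `R` matter.
  separate : ∀ {k e} (c : List A → Fin l) (L M R : List A) →
    k + e ≤ length L → k + e ≤ length R → Blockwise c k L M R →
    (∃ λ u → u ⊆ L ++ M ++ R × length u ≡ k × c u ≢ c (take k L)) →
    Separated c k (k + e) (2 + e) (L ++ M ++ R)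
  separate {k} {e} c L [] R L≥ R≥ block (u , u⊆ , len , neq) with ⊆-++⁻ L u⊆
  -- Moving vertices one at a time from `R` to `L` leads from the counts of the given edge to those
  -- of `take k L`, so some move changes the color.
  ... | v , w , refl , v⊆ , w⊆ with jump g (length v) (length w) (λ eq → neq (trans gp (trans eq gk)))
    where
    g : ℕ → Fin l
    g j = c (take j L ++ take (k ∸ j) R)
    vw≡k : length v + length w ≡ k
    vw≡k = trans (sym (length-++ v)) len
    k≤L : k ≤ length L
    k≤L = ≤-trans (m≤m+n k e) L≥
    gp : c (v ++ w) ≡ g (length v)
    gp = block {t = []} v⊆ (take-⊆ (length v) L) [] w⊆ (take-⊆ (k ∸ length v) R)
           (sym (length-take-≤ _ L (≤-trans (≤-trans (m≤m+n _ _) (≤-reflexive vw≡k)) k≤L)))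
           (trans (sym (trans (cong (_∸ length v) (sym vw≡k)) (m+n∸m≡n (length v) (length w))))
             (sym (length-take-≤ _ R (≤-trans (m∸n≤m k (length v)) (≤-trans (m≤m+n k e) R≥)))))
           len
    gk : g (length w + length v) ≡ c (take k L)
    gk = trans (cong g (trans (+-comm (length w) (length v)) vw≡k))
           (trans (cong (λ n → c (take k L ++ take n R)) (n∸n≡0 k)) (cong c (++-identityʳ _)))
  ...   | j , j< , neq′ = separate-step c L R L≥ R≥ block
    (subst (j <_) (trans (+-comm (length w) (length v)) (trans (sym (length-++ v)) len)) j<) neq′
  separate {k} {e} c L (x ∷ M) R L≥ R≥ block (u , u⊆ , len , neq)
    with constant-or-not c k (L ++ M ++ R) (c (take k L))
  ... | inj₂ other = separated-⊆ (++⁺ (⊆-refl {x = L}) (x ∷ʳ ⊆-refl))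
    (separate c L M R L≥ R≥ (λ u⊆ u′⊆ t⊆ → block u⊆ u′⊆ (x ∷ʳ t⊆)) other)
  ... | inj₁ const with ⊆-++⁻ L u⊆
  ...   | v , w , refl , v⊆ , (.x ∷ʳ w⊆) = contradiction (const (++⁺ v⊆ w⊆) len) neq
  ...   | v , .(x ∷ _) , refl , v⊆ , (refl ∷ w⊆) with ⊆-++⁻ M w⊆
  ...     | t , s , refl , t⊆ , s⊆ =
    separate-pivot c L M R L≥ R≥ block (c (take k L)) const v⊆ t⊆ s⊆ len neq

length-++₃ : (xs ys zs : List A) → length (xs ++ ys ++ zs) ≡ length xs + (length ys + length zs)
length-++₃ xs ys zs = trans (length-++ xs) (cong (length xs +_) (length-++ ys))

-- Adding the fixed vertices `P` and `S` to every edge and every restriction raises edge size and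
-- vertex number equally, so the excess `e` stays the same.
separated-context : ∀ {c : List A → Fin l} {k k′ e s xs ys} P S →
  length P + (k′ + length S) ≡ k → P ++ xs ++ S ⊆ ys →
  Separated (λ w → c (P ++ w ++ S)) k′ (k′ + e) s xs → Separated c k (k + e) s ys
separated-context {k = k} {k′} {e} P S refl ⊆ys (z , h , d) =
  (λ i → P ++ z i ++ S) ,
  (λ i → ⊆-trans (++⁺ (⊆-refl {x = P}) (++⁺ (proj₁ (h i)) ⊆-refl)) ⊆ys ,
         trans (length-++₃ P (z i) S) (trans (cong (λ n → length P + (n + length S)) (proj₂ (h i)))
           (rearrange (length P) k′ e (length S)))) ,
  λ i<j → let (u , v , al , len , neq) = d i<j in
    P ++ u ++ S , P ++ v ++ S ,
    aligned-++ (aligned-refl (⊆-refl {x = P})) (aligned-++ al (aligned-refl (⊆-refl {x = S}))) ,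
    trans (length-++₃ P u S) (cong (λ n → length P + (n + length S)) len) , neq
  where
  rearrange : ∀ p k e s → p + ((k + e) + s) ≡ p + (k + s) + e
  rearrange p k e s = trans (cong (p +_) (trans (+-assoc k e s)
    (trans (cong (k +_) (+-comm e s)) (sym (+-assoc k s e))))) (sym (+-assoc p (k + s) e))

-- Large blocks around a pair that are not twins

-- Cut `xs` into `suc q` segments of length `d`: the at most `q` entries of `u` miss one of them,
-- which becomes the gap.
find-gap : ∀ q d {u} (xs : List A) → u ⊆ xs → length u ≤ q → suc q * d ≤ length xs →
           ∃₂ λ v w → ∃ λ gap → u ≡ v ++ w × v ++ gap ++ w ⊆ xs × length gap ≡ d
find-gap {A = A} q d {u} xs u⊆ le big with ⊆-++⁻ (take d xs) (subst (u ⊆_) (sym (take++drop≡id d xs)) u⊆)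
... | [] , w , refl , _ , w⊆ =
  [] , w , take d xs , refl , subst (take d xs ++ w ⊆_) (take++drop≡id d xs) (++⁺ ⊆-refl w⊆) ,
  length-take-≤ d xs (≤-trans (m≤m+n d (q * d)) big)
find-gap zero    d xs u⊆ () big | a ∷ v , w , refl , _ , _
find-gap (suc q) d xs u⊆ (s≤s le) big | a ∷ v , w , refl , v⊆ , w⊆
  with find-gap q d (drop d xs) w⊆
         (≤-trans (m≤n+m (length w) (length v)) (≤-trans (≤-reflexive (sym (length-++ v))) le))
         (≤-trans (≤-reflexive (sym (m+n∸m≡n d (suc q * d))))
           (≤-trans (∸-monoˡ-≤ d big) (≤-reflexive (sym (length-drop d xs)))))
... | w₁ , w₂ , gap , refl , ⊆xs , len =
  a ∷ v ++ w₁ , w₂ , gap , cong (a ∷_) (sym (++-assoc v w₁ w₂)) ,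
  subst₂ _⊆_ (sym (++-assoc (a ∷ v) w₁ (gap ++ w₂))) (take++drop≡id d xs) (++⁺ v⊆ ⊆xs) , len

-- The left gap is thinned first, against the at most `suc k` vertices between the gaps and the
-- whole right gap, so `gapˡ` involves `gapʳ`. The right gap then faces only the `k + e` vertices
-- kept on the left and those between. The factor `suc k` in `margin` is the number of segments for
-- `find-gap`.
gapʳ gapˡ margin : (l k e : ℕ) → ℕ
gapʳ l k e   = ramsey*# l k ((k + e) + suc k) (k + e)
gapˡ l k e   = ramsey*# l k (suc k + gapʳ l k e) (k + e)
margin l k e = suc k * (gapˡ l k e + gapʳ l k e)

core-length : ∀ {k} {i i′ : A} P W₁ W₂ S → length (P ++ W₁) + suc (length (W₂ ++ S)) ≡ k →
              length (W₁ ++ i ∷ i′ ∷ W₂) ≤ suc k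
core-length {k = k} {i} {i′} P W₁ W₂ S ≡k = begin
  length (W₁ ++ i ∷ i′ ∷ W₂)                    ≡⟨ length-++ W₁ ⟩
  length W₁ + suc (suc (length W₂))             ≡⟨ +-suc (length W₁) _ ⟩
  suc (length W₁ + suc (length W₂))
    ≤⟨ s≤s (+-mono-≤ (≤-trans (m≤n+m _ (length P)) (≤-reflexive (sym (length-++ P))))
                     (s≤s (≤-trans (m≤m+n _ _) (≤-reflexive (sym (length-++ W₂)))))) ⟩
  suc (length (P ++ W₁) + suc (length (W₂ ++ S))) ≡⟨ cong suc ≡k ⟩
  suc k ∎
  where open ≤-Reasoning

-- `u` misses a long gap in `X` and `v` one in `Y`. The vertices `P` before the left gap and `S`
-- after the right gap are fixed, `W₁` and `W₂` stay with the pair, and Ramsey's theorem turns the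
-- gaps into the blocks `L` and `R₀` that `separate` needs.
broken-twins : ∀ {k} e (c : List A → Fin l) (X Y : List A) {i i′ u v} →
  margin l k e ≤ length X → margin l k e ≤ length Y → u ⊆ X → v ⊆ Y →
  length u + suc (length v) ≡ k → c (u ++ i ∷ v) ≢ c (u ++ i′ ∷ v) →
  Separated c k (k + e) (2 + e) (X ++ i ∷ i′ ∷ Y)
broken-twins {A = A} {l = l} {k} e c X Y {i} {i′} {u} {v} X≥ Y≥ u⊆ v⊆ uv≡k neq
  with find-gap k (gapˡ l k e) X u⊆ (≤-trans (m≤m+n _ _) (≤-reflexive uv≡k))
         (≤-trans (*-monoʳ-≤ (suc k) (m≤m+n _ _)) X≥)
     | find-gap k (gapʳ l k e) Y v⊆ (≤-trans (n≤1+n _) (≤-trans (m≤n+m _ (length u)) (≤-reflexive uv≡k)))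
         (≤-trans (*-monoʳ-≤ (suc k) (m≤n+m _ (gapˡ l k e))) Y≥)
... | P , W₁ , L′ , refl , L′⊆ , L′≡ | W₂ , S , R′ , refl , R′⊆ , R′≡
  with ramsey* k (suc k + gapʳ l k e) (k + e) (λ w u → c (P ++ (u ++ w) ++ S))
         ((W₁ ++ i ∷ i′ ∷ W₂) ++ R′)
         (≤-trans (≤-reflexive (length-++ (W₁ ++ i ∷ i′ ∷ W₂))) (+-mono-≤ (core-length P W₁ W₂ S uv≡k) (≤-reflexive R′≡)))
         L′ (≤-reflexive (sym L′≡))
... | L , L⊆ , L≡ , homL
  -- Thinning the right gap afterwards does not harm `homL`, which holds against all of `R′`.
  with ramsey* k ((k + e) + suc k) (k + e) (λ w v → c (P ++ (w ++ v) ++ S))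
         (L ++ W₁ ++ i ∷ i′ ∷ W₂)
         (≤-trans (≤-reflexive (length-++ L)) (+-mono-≤ (≤-reflexive L≡) (core-length P W₁ W₂ S uv≡k)))
         R′ (≤-reflexive (sym R′≡))
... | R₀ , R₀⊆ , R₀≡ , homR =
  separated-context {c = c} P S total context⊆
    (separate c′ L M R₀ L≥ R≥ block other)
  where
  M  = W₁ ++ i ∷ i′ ∷ W₂
  k′ = length (W₁ ++ i ∷ W₂)
  c′ : List A → Fin l
  c′ w = c (P ++ w ++ S)
  regroup : ∀ a → (P ++ W₁) ++ a ∷ (W₂ ++ S) ≡ P ++ (W₁ ++ a ∷ W₂) ++ S
  regroup a = trans (++-assoc P W₁ _) (cong (P ++_) (sym (++-assoc W₁ (a ∷ W₂) S)))
  total : length P + (k′ + length S) ≡ k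
  total = trans (sym (length-++₃ P (W₁ ++ i ∷ W₂) S))
    (trans (cong length (sym (regroup i))) (trans (length-++ (P ++ W₁)) uv≡k))
  k′≤k : k′ ≤ k
  k′≤k = ≤-trans (≤-trans (m≤m+n k′ (length S)) (m≤n+m _ (length P))) (≤-reflexive total)
  L≥ : k′ + e ≤ length L
  L≥ = ≤-trans (+-monoˡ-≤ e k′≤k) (≤-reflexive (sym L≡))
  R≥ : k′ + e ≤ length R₀
  R≥ = ≤-trans (+-monoˡ-≤ e k′≤k) (≤-reflexive (sym R₀≡))
  block : Blockwise c′ k′ L M R₀
  block {u} {u′} {t} {v} {v′} u⊆ u′⊆ t⊆ v⊆ v′⊆ uu′ vv′ len = begin
    c′ (u ++ t ++ v)    ≡⟨ homL (++⁺ t⊆ (⊆-trans v⊆ R₀⊆)) u⊆ u′⊆ uu′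
                             (≤-trans (≤-trans (m≤m+n _ _) (≤-reflexive (trans (sym (length-++ u)) len))) k′≤k) ⟩
    c′ (u′ ++ t ++ v)   ≡⟨ cong c′ (sym (++-assoc u′ t v)) ⟩
    c′ ((u′ ++ t) ++ v) ≡⟨ homR (++⁺ u′⊆ t⊆) v⊆ v′⊆ vv′
                             (≤-trans (≤-trans (≤-trans (m≤n+m _ (length t)) (m≤n+m _ (length u)))
                               (≤-reflexive (trans (sym (length-++₃ u t v)) len))) k′≤k) ⟩
    c′ ((u′ ++ t) ++ v′) ≡⟨ cong c′ (++-assoc u′ t v′) ⟩
    c′ (u′ ++ t ++ v′)  ∎
    where open ≡-Reasoning
  in-M : ∀ {w} → w ⊆ M → w ⊆ L ++ M ++ R₀
  in-M w⊆ = ++⁺ˡ L (++⁺ʳ R₀ w⊆)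
  other : ∃ λ w → w ⊆ L ++ M ++ R₀ × length w ≡ k′ × c′ w ≢ c′ (take k′ L)
  -- The edges through `i` and `i′` have different colors, so at least one of them differs from the
  -- color of `take k′ L`.
  other with c′ (W₁ ++ i ∷ W₂) Fin.≟ c′ (take k′ L)
  ... | no neq₁ = _ , in-M (++⁺ (⊆-refl {x = W₁}) (refl ∷ i′ ∷ʳ ⊆-refl)) , refl , neq₁
  ... | yes eq₁ = W₁ ++ i′ ∷ W₂ , in-M (++⁺ (⊆-refl {x = W₁}) (i ∷ʳ refl ∷ ⊆-refl)) ,
    trans (length-++ W₁) (sym (length-++ W₁)) ,
    λ eq₂ → neq (trans (cong c (regroup i)) (trans eq₁ (trans (sym eq₂) (cong c (sym (regroup i′))))))
  context⊆ : P ++ (L ++ M ++ R₀) ++ S ⊆ X ++ i ∷ i′ ∷ Y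
  context⊆ = ⊆-trans (⊆-reflexive (sym eq))
    (++⁺ (⊆-trans (++⁺ (⊆-refl {x = P}) (++⁺ L⊆ ⊆-refl)) L′⊆)
         (refl ∷ refl ∷ ⊆-trans (++⁺ (⊆-refl {x = W₂}) (++⁺ R₀⊆ ⊆-refl)) R′⊆))
    where
    eq : (P ++ L ++ W₁) ++ i ∷ i′ ∷ (W₂ ++ R₀ ++ S) ≡ P ++ (L ++ M ++ R₀) ++ S
    eq = trans (++-assoc P (L ++ W₁) _) (cong (P ++_)
      (trans (++-assoc L W₁ _) (trans (cong (L ++_)
        (trans (sym (++-assoc W₁ (i ∷ i′ ∷ W₂) (R₀ ++ S))) (sym (++-assoc M R₀ S))))
        (sym (++-assoc L (M ++ R₀) S)))))

-- Deleting a vertex from a run of twins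

TwinsInside : (List A → Fin l) → (k D : ℕ) → List A → Set
TwinsInside c k D xs = ∀ X {i i′} Y {u v} → xs ≡ X ++ i ∷ i′ ∷ Y → D ≤ length X → D ≤ length Y →
  u ⊆ X → v ⊆ Y → length u + suc (length v) ≡ k → c (u ++ i ∷ v) ≡ c (u ++ i′ ∷ v)

-- An edge containing d but not all of V is pushed off d: if it continues with v ∈ V,
-- first push it off v into the rest of V, and then exchange the twins d and v.
shift : ∀ {l k} D {xs : List A} X d V Y {w} → xs ≡ X ++ d ∷ V ++ Y → D ≤ length X → D ≤ length Y →
  w ⊆ V → length w < length V →
  ∃ λ w′ → w′ ⊆ V × length w′ ≡ suc (length w) ×
    (∀ (c : List A → Fin l) → TwinsInside c k D xs → ∀ {u s} → u ⊆ X → s ⊆ Y →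
      length u + suc (length w + length s) ≡ k →
      c (u ++ d ∷ w ++ s) ≡ c (u ++ w′ ++ s))
shift D X d (v ∷ V) Y {w} eq X≥ Y≥ (.v ∷ʳ w⊆) _ =
  v ∷ w , refl ∷ w⊆ , refl , λ c twins {u} {s} u⊆ s⊆ len →
    twins X (V ++ Y) eq X≥ (≤-trans Y≥ (≤-trans (m≤n+m _ (length V)) (≤-reflexive (sym (length-++ V)))))
      u⊆ (++⁺ w⊆ s⊆) (trans (cong (λ n → length u + suc n) (length-++ w)) len)
shift D X d (v ∷ V) Y {v ∷ w} eq X≥ Y≥ (refl ∷ w⊆) (s≤s w<)
  with shift D (X ++ d ∷ []) v V Y (trans eq (sym (++-assoc X (d ∷ []) _)))
         (≤-trans X≥ (≤-trans (m≤m+n _ 1) (≤-reflexive (sym (length-++ X))))) Y≥ w⊆ w<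
... | w′ , w′⊆ , len′ , shifted =
  v ∷ w′ , refl ∷ w′⊆ , cong suc len′ , λ c twins {u} {s} u⊆ s⊆ len → begin
    c (u ++ d ∷ (v ∷ w) ++ s)       ≡⟨ cong c (sym (++-assoc u (d ∷ []) _)) ⟩
    c ((u ++ d ∷ []) ++ v ∷ w ++ s) ≡⟨ shifted c twins (++⁺ u⊆ ⊆-refl) s⊆
                                         (trans (cong (_+ suc (length w + length s)) (length-++ u))
                                           (trans (+-assoc (length u) 1 _) len)) ⟩
    c ((u ++ d ∷ []) ++ w′ ++ s)    ≡⟨ cong c (++-assoc u (d ∷ []) _) ⟩
    c (u ++ d ∷ w′ ++ s)            ≡⟨ twins X (V ++ Y) eq X≥
                                         (≤-trans Y≥ (≤-trans (m≤n+m _ (length V)) (≤-reflexive (sym (length-++ V)))))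
                                         u⊆ (++⁺ w′⊆ s⊆)
                                         (trans (cong (λ n → length u + suc n)
                                           (trans (length-++ w′) (cong (_+ length s) len′))) len) ⟩
    c (u ++ v ∷ w′ ++ s)            ∎
  where open ≡-Reasoning

-- An edge through `d` has at most `k - 1` vertices in `V`, so it misses one and `shift` replaces it
-- by an edge avoiding `d`. The replacement does not depend on the coloring, so `c` and `c′` are
-- compared on the same edge.
determined-by-deletion : ∀ {l k} D (c c′ : List A → Fin l) X d V Y →
  D ≤ length X → D ≤ length Y → k ≤ length V →
  TwinsInside c k D (X ++ d ∷ V ++ Y) → TwinsInside c′ k D (X ++ d ∷ V ++ Y) →
  (∀ {u} → u ⊆ X ++ V ++ Y → length u ≡ k → c u ≡ c′ u) →
  ∀ {u} → u ⊆ X ++ d ∷ V ++ Y → length u ≡ k → c u ≡ c′ u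
determined-by-deletion {k = k} D c c′ X d V Y X≥ Y≥ V≥ twins twins′ agree u⊆ len
  with ⊆-++⁻ X u⊆
... | u , s , refl , u⊆X , (.d ∷ʳ s⊆) = agree (++⁺ u⊆X s⊆) len
... | u , .(d ∷ _) , refl , u⊆X , (refl ∷ s⊆) with ⊆-++⁻ V s⊆
...   | w , s , refl , w⊆ , s⊆Y
  with shift {k = k} D X d V Y refl X≥ Y≥ w⊆ (≤-trans (≤-trans (s≤s (m≤m+n _ _)) (m≤n+m _ (length u))) (≤-trans (≤-reflexive len′) V≥))
  where
  len′ : length u + suc (length w + length s) ≡ k
  len′ = trans (cong (λ n → length u + suc n) (sym (length-++ w))) (trans (sym (length-++ u)) len)
...     | w′ , w′⊆ , lw′ , shifted =
  trans (shifted c twins u⊆X s⊆Y len′)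
    (trans (agree (++⁺ u⊆X (++⁺ w′⊆ s⊆Y)) len″) (sym (shifted c′ twins′ u⊆X s⊆Y len′)))
  where
  len′ : length u + suc (length w + length s) ≡ k
  len′ = trans (cong (λ n → length u + suc n) (sym (length-++ w))) (trans (sym (length-++ u)) len)
  len″ : length (u ++ w′ ++ s) ≡ k
  len″ = trans (length-++₃ u w′ s) (trans (cong (λ n → length u + (n + length s)) lw′) len′)

-- Colorings as functions on lists

setOf : List (Fin n) → Subset n
setOf = foldr (λ i E → ⁅ i ⁆ ∪ E) Subset.⊥

-- Total on subsets, so that no proof of cardinality has to be carried along; `q` is an arbitrary
-- value for the wrong sizes.
extend : (KSubset k n → Fin l) → Fin l → Subset n → Fin l
extend {k = k} χ q E with ∣ E ∣ ≟ k
... | yes eq = χ (E , eq)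
... | no  _  = q

extend-≡ : ∀ (χ : KSubset k n → Fin l) q E → extend χ q (proj₁ E) ≡ χ E
extend-≡ {k = k} χ q (E , eq) with ∣ E ∣ ≟ k
... | yes eq′ = cong (λ p → χ (E , p)) (≡-irrelevant eq′ eq)
... | no  neq = contradiction eq neq

listColor : (KSubset k n → Fin l) → Fin l → List (Fin n) → Fin l
listColor χ q u = extend χ q (setOf u)

at : (z : List A) → length z ≡ m → Fin m → A
at z eq i = lookup z (cast (sym eq) i)

AllPairs-resp-⊆ : {_∼_ : A → A → Set} {xs ys : List A} → xs ⊆ ys → AllPairs _∼_ ys → AllPairs _∼_ xs
AllPairs-resp-⊆ []         []       = []
AllPairs-resp-⊆ (y ∷ʳ τ)   (_ ∷ ps) = AllPairs-resp-⊆ τ ps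
AllPairs-resp-⊆ (refl ∷ τ) (p ∷ ps) = All-resp-⊆ τ p ∷ AllPairs-resp-⊆ τ ps

AllPairs-lookup : {_∼_ : A → A → Set} {xs : List A} → AllPairs _∼_ xs →
                  ∀ {i j} → i Fin.< j → lookup xs i ∼ lookup xs j
AllPairs-lookup (p ∷ _)  {zero}  {suc j} _         = All.lookup p (∈-lookup j)
AllPairs-lookup (_ ∷ ps) {suc i} {suc j} (s≤s i<j) = AllPairs-lookup ps i<j

module _ {z : List (Fin n)} (z⊆ : z ⊆ allFin n) (eq : length z ≡ m) where

  at-increasing : at z eq Preserves Fin._<_ ⟶ Fin._<_
  at-increasing {i} {j} i<j =
    AllPairs-lookup (AllPairs-resp-⊆ z⊆ (AllPairs.tabulate⁺-< id))
      (subst₂ _<_ (sym (Fin.toℕ-cast (sym eq) i)) (sym (Fin.toℕ-cast (sym eq) j)) i<j)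

  at-injective : Injective _≡_ _≡_ (at z eq)
  at-injective {i} {j} e with Fin.<-cmp i j
  ... | tri< i<j _ _ = contradiction (at-increasing i<j) (Fin.<-irrefl e)
  ... | tri≈ _ i≡j _ = i≡j
  ... | tri> _ _ j<i = contradiction (at-increasing j<i) (Fin.<-irrefl (sym e))

  restrict : (KSubset k n → Fin l) → KSubset k m → Fin l
  restrict χ = χ ∘ imageₖ (at z eq) at-injective

  restrict-⪯ : .{{_ : NonZero m}} .{{_ : NonZero n}} (χ : KSubset k n → Fin l) →
               coloring m (restrict χ) ⪯ coloring n χ
  restrict-⪯ χ = record
    { embed = at z eq ; injective = at-injective ; increasing = at-increasing ; preserves = λ _ → refl }

  restrict-≡ : ∀ (χ : KSubset k n → Fin l) q E u → image (at z eq) (proj₁ E) ≡ setOf u →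
               restrict χ E ≡ listColor χ q u
  restrict-≡ χ q E u im = trans (sym (extend-≡ χ q (imageₖ (at z eq) at-injective E))) (cong (extend χ q) im)

-- `E` is the set of common positions: one edge on `m` vertices with two images, which is where two
-- restrictions are compared.
aligned⇒image : ∀ {u v y z : List (Fin n)} → Aligned u v y z → (p : length y ≡ m) (q : length z ≡ m) →
  ∃ λ E → ∣ E ∣ ≡ length u × image (at y p) E ≡ setOf u × image (at z q) E ≡ setOf v
aligned⇒image {m = zero}  []            p q = [] , refl , refl , refl
aligned⇒image {m = suc m} (skip a b al) p q
  with aligned⇒image al (suc-injective p) (suc-injective q)
... | E , card , eq , eq′ = outside ∷ E , card , eq , eq′
aligned⇒image {m = suc m} (keep a b al) p q
  with aligned⇒image al (suc-injective p) (suc-injective q)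
... | E , card , eq , eq′ = inside ∷ E , cong suc card , cong (⁅ a ⁆ ∪_) eq , cong (⁅ b ⁆ ∪_) eq′

restrict-distinct : ∀ {y z : List (Fin n)} (y⊆ : y ⊆ allFin n) (z⊆ : z ⊆ allFin n)
  (p : length y ≡ m) (p′ : length z ≡ m) (χ : KSubset k n → Fin l) q →
  Distinct (listColor χ q) k y z → ¬ (∀ E → restrict y⊆ p χ E ≡ restrict z⊆ p′ χ E)
restrict-distinct y⊆ z⊆ p p′ χ q (u , v , al , refl , neq) same with aligned⇒image al p p′
... | E , card , eq , eq′ = neq (trans (sym (restrict-≡ y⊆ p χ q (E , card) u eq))
                                  (trans (same (E , card)) (restrict-≡ z⊆ p′ χ q (E , card) v eq′)))

restrict-agree : ∀ {z : List (Fin n)} (z⊆ : z ⊆ allFin n) (p : length z ≡ m)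
  (χ χ′ : KSubset k n → Fin l) q → (∀ E → restrict z⊆ p χ E ≡ restrict z⊆ p χ′ E) →
  ∀ {u} → u ⊆ z → length u ≡ k → listColor χ q u ≡ listColor χ′ q u
restrict-agree z⊆ p χ χ′ q same {u} u⊆ refl with aligned⇒image (aligned-refl u⊆) p p
... | E , card , eq , _ = trans (sym (restrict-≡ z⊆ p χ q (E , card) u eq))
                            (trans (same (E , card)) (restrict-≡ z⊆ p χ′ q (E , card) u eq))

select : (f : Fin m → A) → Subset m → List A
select f []            = []
select f (inside  ∷ E) = f zero ∷ select (f ∘ suc) E
select f (outside ∷ E) = select (f ∘ suc) E

select-⊆ : (f : Fin m → A) (E : Subset m) → select f E ⊆ tabulate f
select-⊆ f []            = []
select-⊆ f (inside  ∷ E) = refl ∷ select-⊆ (f ∘ suc) E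
select-⊆ f (outside ∷ E) = f zero ∷ʳ select-⊆ (f ∘ suc) E

length-select : (f : Fin m → A) (E : Subset m) → length (select f E) ≡ ∣ E ∣
length-select f []            = refl
length-select f (inside  ∷ E) = cong suc (length-select (f ∘ suc) E)
length-select f (outside ∷ E) = length-select (f ∘ suc) E

setOf-select : (f : Fin m → Fin n) (E : Subset m) → setOf (select f E) ≡ image f E
setOf-select f []            = refl
setOf-select f (inside  ∷ E) = cong (⁅ f zero ⁆ ∪_) (setOf-select (f ∘ suc) E)
setOf-select f (outside ∷ E) = setOf-select (f ∘ suc) E

image-id : (E : Subset n) → image id E ≡ E
image-id E = Subset.⊆-antisym
  (λ j∈ → let (_ , i∈ , eq) = ∈-image⁻ id E j∈ in subst (Subset._∈ E) eq i∈)
  (∈-image⁺ id)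

-- Every `k`-subset is `setOf` of the sublist of `allFin n` that `select id` reads off.
extend-agree : (χ χ′ : KSubset k n → Fin l) (q : Fin l) →
  (∀ {u} → u ⊆ allFin n → length u ≡ k → listColor χ q u ≡ listColor χ′ q u) →
  ∀ E → χ E ≡ χ′ E
extend-agree χ χ′ q agree (E , card) = begin
  χ (E , card)                 ≡⟨ sym (extend-≡ χ q (E , card)) ⟩
  extend χ q E                 ≡⟨ cong (extend χ q) (sym eq) ⟩
  extend χ q (setOf (select id E)) ≡⟨ agree (select-⊆ id E) (trans (length-select id E) card) ⟩
  extend χ′ q (setOf (select id E)) ≡⟨ cong (extend χ′ q) eq ⟩
  extend χ′ q E                ≡⟨ extend-≡ χ′ q (E , card) ⟩
  χ′ (E , card)                ∎
  where
  open ≡-Reasoning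
  eq : setOf (select id E) ≡ E
  eq = trans (setOf-select id E) (image-id E)

-- Cardinalities

enumerate : {P : Fin n → Set ℓ} → (∀ i → Dec (P i)) →
  ∃ λ c → ∃ λ (e : Fin c → Fin n) → Injective _≡_ _≡_ e × (∀ i → P (e i)) × (∀ j → P j → ∃ λ i → e i ≡ j)
enumerate {n = zero}  P? = 0 , (λ ()) , (λ { {()} }) , (λ ()) , λ ()
enumerate {n = suc n} P? with P? zero | enumerate (P? ∘ suc)
... | yes p | c , e , inj , sound , complete = suc c , e′ , inj′ , sound′ , complete′
  where
  e′ : Fin (suc c) → Fin (suc n)
  e′ zero    = zero
  e′ (suc i) = suc (e i)
  inj′ : Injective _≡_ _≡_ e′
  inj′ {zero}  {zero}  _  = refl
  inj′ {suc i} {suc j} eq = cong suc (inj (Fin.suc-injective eq))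
  sound′ : ∀ i → _
  sound′ zero    = p
  sound′ (suc i) = sound i
  complete′ : ∀ j → _ → ∃ λ i → e′ i ≡ j
  complete′ zero    _ = zero , refl
  complete′ (suc j) q = let (i , eq) = complete j q in suc i , cong suc eq
... | no ¬p | c , e , inj , sound , complete =
  c , suc ∘ e , inj ∘ Fin.suc-injective , sound , complete′
  where
  complete′ : ∀ j → _ → ∃ λ i → suc (e i) ≡ j
  complete′ zero    q = contradiction q ¬p
  complete′ (suc j) q = let (i , eq) = complete j q in i , cong suc eq

-- Membership in an ideal need not be decidable, so excluded middle settles which codes are
-- attained, and these are counted.
finite : ExcludedMiddle a → (S : Setoid a ℓ) → let open Setoid S in
  (code : Carrier → Fin n) → (∀ {x y} → x ≈ y → code x ≡ code y) → (∀ {x y} → code x ≡ code y → x ≈ y) →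
  ∃ λ c → HasCardinality S c
finite em S code code-cong code-inj with enumerate {P = λ j → ∃ λ s → code s ≡ j} (λ _ → em)
... | c , e , e-inj , sound , complete = c , record
  { to        = to
  ; from      = from
  ; to-cong   = λ { refl → 𝕊.refl }
  ; from-cong = λ x≈y → e-inj (trans (e-from _) (trans (code-cong x≈y) (sym (e-from _))))
  ; inverse   = (λ { {s} refl → code-inj (trans (code-to (from s)) (e-from s)) })
              , (λ {i} s≈ → e-inj (trans (e-from _) (trans (code-cong s≈) (code-to i))))
  }
  where
  module 𝕊 = Setoid S
  to : Fin c → 𝕊.Carrier
  to i = proj₁ (sound i)
  code-to : ∀ i → code (to i) ≡ e i
  code-to i = proj₂ (sound i)
  from : 𝕊.Carrier → Fin c
  from s = proj₁ (complete (code s) (s , refl))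
  e-from : ∀ s → e (from s) ≡ code s
  e-from s = proj₂ (complete (code s) (s , refl))

cardinality-≤ : ∀ {b ℓ′} {S : Setoid a ℓ} {T : Setoid b ℓ′} {c d} → HasCardinality S c → HasCardinality T d →
  (f : Setoid.Carrier S → Setoid.Carrier T) →
  (∀ {x y} → Setoid._≈_ T (f x) (f y) → Setoid._≈_ S x y) → c ≤ d
cardinality-≤ {S = S} {T} cardS cardT f f-inj = Fin.injective⇒≤ {f = Inverse.from cardT ∘ f ∘ Inverse.to cardS}
  (λ {i} {j} eq → trans (sym (Inverse.inverseʳ cardS 𝕊.refl))
    (trans (Inverse.from-cong cardS (f-inj (𝕋.trans (𝕋.sym (Inverse.inverseˡ cardT refl))
      (Inverse.inverseˡ cardT eq)))) (Inverse.inverseʳ cardS 𝕊.refl)))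
  where
  module 𝕊 = Setoid S
  module 𝕋 = Setoid T

-- This is l^(2^n), the number of maps from `Subset n` to `Fin l`.
codes : ℕ → ℕ → ℕ
codes l zero    = l
codes l (suc n) = codes l n * codes l n

encode : (Subset n → Fin l) → Fin (codes l n)
encode {n = zero}  g = g []
encode {n = suc n} g = Fin.combine (encode (g ∘ (inside ∷_))) (encode (g ∘ (outside ∷_)))

encode-cong : {g h : Subset n → Fin l} → (∀ E → g E ≡ h E) → encode g ≡ encode h
encode-cong {n = zero}  eq = eq []
encode-cong {n = suc n} eq =
  cong₂ Fin.combine (encode-cong (eq ∘ (inside ∷_))) (encode-cong (eq ∘ (outside ∷_)))

encode-injective : {g h : Subset n → Fin l} → encode g ≡ encode h → ∀ E → g E ≡ h E
encode-injective {n = zero}  eq []            = eq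
encode-injective {n = suc n} {g = g} {h} eq E with Fin.combine-injective
  (encode (g ∘ (inside ∷_))) (encode (g ∘ (outside ∷_))) (encode (h ∘ (inside ∷_))) (encode (h ∘ (outside ∷_))) eq
encode-injective eq (inside  ∷ E) | eq₁ , _ = encode-injective eq₁ E
encode-injective eq (outside ∷ E) | _ , eq₂ = encode-injective eq₂ E

section-finite : ExcludedMiddle ℓ → Fin l → (X : Pred (Coloring k l) ℓ) → ∀ n .{{_ : NonZero n}} →
                 ∃ λ c → HasCardinality (Section X n) c
section-finite {k = k} em q X n = finite em (Section X n) (λ χ → encode (extend (proj₁ χ) q))
  (λ {χ} {χ′} eq → encode-cong (extend-cong (proj₁ χ) (proj₁ χ′) eq))
  (λ {χ} {χ′} eq E → trans (sym (extend-≡ (proj₁ χ) q E))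
     (trans (encode-injective eq (proj₁ E)) (extend-≡ (proj₁ χ′) q E)))
  where
  extend-cong : ∀ (χ χ′ : KSubset k n → Fin _) → (∀ E → χ E ≡ χ′ E) → ∀ E → extend χ q E ≡ extend χ′ q E
  extend-cong χ χ′ eq E with ∣ E ∣ ≟ k
  ... | yes p = eq (E , p)
  ... | no  _ = refl

-- Descent on the value: if `f` ever drops below `f n₁`, restart from there; otherwise monotonicity
-- makes it constant.
eventually-constant : (∀ {P : Set} → Dec P) → (f : ℕ → ℕ) (n₀ : ℕ) → (∀ n → n₀ ≤ n → f (suc n) ≤ f n) →
                      ∃₂ λ c n₁ → ∀ n → n₁ ≤ n → f n ≡ c
eventually-constant em f n₀ h = go n₀ ≤-refl (<-wellFounded (f n₀))
  where
  antitone : ∀ {n₁} → n₀ ≤ n₁ → ∀ d → f (d + n₁) ≤ f n₁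
  antitone le zero    = ≤-refl
  antitone le (suc d) = ≤-trans (h _ (≤-trans le (m≤n+m _ d))) (antitone le d)
  go : ∀ n₁ → n₀ ≤ n₁ → Acc _<_ (f n₁) → ∃₂ λ c n₁ → ∀ n → n₁ ≤ n → f n ≡ c
  go n₁ le (acc rs) with em {∃ λ n → n₁ ≤ n × f n < f n₁}
  ... | yes (n , n₁≤n , f<) = go n (≤-trans le n₁≤n) (rs f<)
  ... | no  none = f n₁ , n₁ , λ n n₁≤n → ≤-antisym
    (subst (λ i → f i ≤ f n₁) (m∸n+n≡m n₁≤n) (antitone le (n ∸ n₁)))
    (≮⇒≥ λ f< → none (n , n₁≤n , f<))

-- Sections of an ideal and the dichotomy

split-around : ∀ {A : Set} D k (xs : List A) → D + suc (k + D) ≤ length xs →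
  ∃₂ λ L d → ∃₂ λ V R → xs ≡ L ++ d ∷ V ++ R × length L ≡ D × length V ≡ k × D ≤ length R
split-around D k xs big with drop D xs in eq
... | [] = contradiction (≤-trans rest≥ (≤-reflexive (cong length eq))) λ ()
  where
  rest≥ : suc (k + D) ≤ length (drop D xs)
  rest≥ = subst₂ _≤_ (m+n∸m≡n D _) (sym (length-drop D xs)) (∸-monoˡ-≤ D big)
... | d ∷ rest = take D xs , d , take k rest , drop k rest ,
  trans (sym (take++drop≡id D xs)) (cong (take D xs ++_) (trans eq (cong (d ∷_) (sym (take++drop≡id k rest))))) ,
  length-take-≤ D xs (≤-trans (m≤m+n D _) big) ,
  length-take-≤ k rest (≤-trans (m≤m+n k D) rest≥) ,
  subst₂ _≤_ (m+n∸m≡n k D) (sym (length-drop k rest)) (∸-monoˡ-≤ k rest≥)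
  where
  rest≥ : k + D ≤ length rest
  rest≥ = ≤-pred (subst₂ _≤_ (m+n∸m≡n D _) (trans (sym (length-drop D xs)) (cong length eq)) (∸-monoˡ-≤ D big))

module _ {ℓ} {k l : ℕ} {X : Pred (Coloring k l) ℓ} (ideal : IsIdeal X) where

  restrictₛ : ∀ {n m} .{{_ : NonZero n}} .{{_ : NonZero m}} {z : List (Fin n)} →
    z ⊆ allFin n → length z ≡ m → Setoid.Carrier (Section X n) → Setoid.Carrier (Section X m)
  restrictₛ z⊆ eq (χ , x) = restrict z⊆ eq χ , ideal (restrict-⪯ z⊆ eq χ) x

  separated-bound : ∀ {n m s c} .{{_ : NonZero n}} .{{_ : NonZero m}} (q : Fin l)
    (χ : Setoid.Carrier (Section X n)) → Separated (listColor (proj₁ χ) q) k m s (allFin n) →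
    HasCardinality (Section X m) c → s ≤ c
  separated-bound {n} {m} {s} {c} q χ (z , h , distinct) card =
    cardinality-≤ {S = setoid (Fin s)} {T = Section X m} (Identity.inverse _) card member member-injective
    where
    member : Fin s → Setoid.Carrier (Section X m)
    member i = restrictₛ (proj₁ (h i)) (proj₂ (h i)) χ
    apart : ∀ {i j} → i Fin.< j → ¬ Setoid._≈_ (Section X m) (member i) (member j)
    apart {i} {j} i<j = restrict-distinct (proj₁ (h i)) (proj₁ (h j)) (proj₂ (h i)) (proj₂ (h j))
                          (proj₁ χ) q (distinct i<j)
    member-injective : ∀ {i j} → Setoid._≈_ (Section X m) (member i) (member j) → i ≡ j
    member-injective {i} {j} same with Fin.<-cmp i j
    ... | tri< i<j _ _ = contradiction same (apart i<j)
    ... | tri≈ _ i≡j _ = i≡j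
    ... | tri> _ _ j<i = contradiction (λ E → sym (same E)) (apart j<i)

  -- The contrapositive of `broken-twins`: with `m = k + e` the bound on `c` reads |X_m| < m - k +
  -- 2. The margin depends on `l`, `k` and `e` alone, so it serves all `n` and `χ`.
  twins-inside : ∀ {n m e c} .{{_ : NonZero n}} .{{_ : NonZero m}} (q : Fin l) →
    k + e ≡ m → HasCardinality (Section X m) c → c < 2 + e → (χ : Setoid.Carrier (Section X n)) →
    TwinsInside (listColor (proj₁ χ) q) k (margin l k e) (allFin n)
  twins-inside {n} {e = e} q refl card c< χ L {i} {i′} R {u} {v} eq L≥ R≥ u⊆ v⊆ len
    with listColor (proj₁ χ) q (u ++ i ∷ v) Fin.≟ listColor (proj₁ χ) q (u ++ i′ ∷ v)
  ... | yes same = same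
  ... | no  neq  = contradiction
    (separated-bound q χ (subst (Separated _ k (k + e) (2 + e)) (sym eq)
      (broken-twins e (listColor (proj₁ χ) q) L R L≥ R≥ u⊆ v⊆ len neq)) card)
    (<⇒≱ c<)

  -- Since `D` works for all colorings at once, the same vertex `d` can be deleted from each of
  -- them, and by `determined-by-deletion` nothing is lost.
  deletion-injective : ∀ {n D} (q : Fin l) → D + (k + D) ≤ n →
    ((χ : Setoid.Carrier (Section X (2 + n))) → TwinsInside (listColor (proj₁ χ) q) k D (allFin (2 + n))) →
    ∃ λ (f : Setoid.Carrier (Section X (2 + n)) → Setoid.Carrier (Section X (1 + n))) →
      ∀ {χ χ′} → Setoid._≈_ (Section X (1 + n)) (f χ) (f χ′) → Setoid._≈_ (Section X (2 + n)) χ χ′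
  deletion-injective {n} {D} q n≥ twins
    with split-around D k (allFin (2 + n)) (≤-trans (≤-reflexive (+-suc D (k + D)))
           (≤-trans (s≤s (≤-trans n≥ (n≤1+n n))) (≤-reflexive (sym (length-tabulate {n = 2 + n} id)))))
  ... | L , d , V , R , eq , L≡ , V≡ , R≥ =
    restrictₛ z⊆ len , λ {χ} {χ′} same → extend-agree (proj₁ χ) (proj₁ χ′) q λ {u} u⊆ →
      determined-by-deletion D (listColor (proj₁ χ) q) (listColor (proj₁ χ′) q) L d V R
        (≤-reflexive (sym L≡)) R≥ (≤-reflexive (sym V≡))
        (subst (TwinsInside (listColor (proj₁ χ) q) k D) eq (twins χ)) (subst (TwinsInside (listColor (proj₁ χ′) q) k D) eq (twins χ′))
        (restrict-agree z⊆ len (proj₁ χ) (proj₁ χ′) q same) (subst (u ⊆_) eq u⊆)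
    where
    z⊆ : L ++ V ++ R ⊆ allFin (2 + n)
    z⊆ = subst (L ++ V ++ R ⊆_) (sym eq) (++⁺ (⊆-refl {x = L}) (d ∷ʳ ⊆-refl))
    len : length (L ++ V ++ R) ≡ 1 + n
    len = suc-injective (begin
      suc (length (L ++ V ++ R))         ≡⟨ cong suc (length-++ L) ⟩
      suc (length L + length (V ++ R))   ≡⟨ sym (+-suc (length L) _) ⟩
      length L + length (d ∷ V ++ R)     ≡⟨ sym (length-++ L) ⟩
      length (L ++ d ∷ V ++ R)           ≡⟨ cong length (sym eq) ⟩
      length (allFin (2 + n))            ≡⟨ length-tabulate {n = 2 + n} id ⟩
      2 + n                              ∎)
      where open ≡-Reasoning

-- `f N` counts the members on `N + 1` vertices. If they are fewer than (N + 1) - k + 2, then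
-- `twins-inside` makes deletion injective on all large sections.
small⇒antitone : ∀ {ℓ} {k l : ℕ} {X : Pred (Coloring k l) ℓ} → IsIdeal X → Fin l →
  (f : ℕ → ℕ) → (∀ n → HasCardinality (Section X (suc n)) (f n)) →
  ∀ {N} → f N + k < suc N + 2 → ∃ λ n₀ → ∀ n → n₀ ≤ n → f (suc n) ≤ f n
small⇒antitone {k = k} {l} {X} ideal q f card {N} small with k ≤? suc N
-- For `suc N < k` the hypothesis forces the section on `N + 1` vertices to be empty. Larger
-- sections are then empty too, since their members restrict to it.
... | no  k≰ = N , λ n N≤n →
  cardinality-≤ {S = Section X (2 + n)} {T = Section X (1 + n)} (card (suc n)) (card n)
    (λ χ → contradiction χ (empty n N≤n)) (λ {χ} _ → contradiction χ (empty n N≤n))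
  where
  fN≡0 : f N ≡ 0
  fN≡0 = n<1⇒n≡0 (+-cancelʳ-< k (f N) 1 (<-≤-trans small
    (≤-trans (≤-reflexive (+-comm (suc N) 2)) (s≤s (≰⇒> k≰)))))
  empty : ∀ n → N ≤ n → ¬ Setoid.Carrier (Section X (2 + n))
  empty n N≤n χ = Fin.¬Fin0 (subst Fin fN≡0 (Inverse.from (card N) (restrictₛ {X = X} ideal
    (take-⊆ (suc N) (allFin (2 + n)))
    (length-take-≤ (suc N) (allFin (2 + n)) (≤-trans (s≤s (≤-trans N≤n (n≤1+n n))) (≤-reflexive (sym (length-tabulate {n = 2 + n} id))))) χ)))
... | yes k≤ with suc N ∸ k | m+[n∸m]≡n k≤
...   | e | eq = D + (k + D) , λ n n≥ →
  let (g , g-inj) = deletion-injective {X = X} ideal q n≥ (twins n) in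
  cardinality-≤ {S = Section X (2 + n)} {T = Section X (1 + n)} (card (suc n)) (card n) g
    (λ {χ} {χ′} → g-inj {χ} {χ′})
  where
  D = margin l k e
  twins : ∀ n χ → TwinsInside (listColor (proj₁ χ) q) k D (allFin (2 + n))
  twins n = twins-inside {X = X} ideal q eq (card N) (+-cancelʳ-< k (f N) (2 + e) (<-≤-trans small
    (≤-reflexive (trans (cong (_+ 2) (sym eq)) (trans (+-comm (k + e) 2) (cong (2 +_) (+-comm k e)))))))

dichotomy : ∀ {ℓ} → (∀ {P : Set} → Dec P) → {k l : ℕ} {X : Pred (Coloring k l) ℓ} → IsIdeal X → Fin l →
  (f : ℕ → ℕ) → (∀ n → HasCardinality (Section X (suc n)) (f n)) →
  (∃ λ (c : ℕ) → ∃ λ (n₀ : ℕ) →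
    (n : ℕ) → .{{_ : NonZero n}} → n₀ < n → HasCardinality (Section X n) c)
  ⊎
  ((n : ℕ) → .{{_ : NonZero n}} →
    ∃ λ (c : ℕ) → HasCardinality (Section X n) c × n + 2 ≤ c + k)
-- If no section is below the bound, negating the inequality gives the second alternative; `k` is
-- added on the other side to avoid truncated subtraction.
dichotomy em₀ {k} {l} {X} ideal q f card with em₀ {∃ λ N → f N + k < suc N + 2}
... | no  none = inj₂ λ { (suc n) → f n , card n , ≮⇒≥ (λ lt → none (n , lt)) }
... | yes (N , small) with small⇒antitone ideal q f card {N} small
...   | n₀ , antitone with eventually-constant em₀ f n₀ antitone
...     | c , n₁ , constant = inj₁ (c , n₁ , λ { (suc n) n₁<n →
  subst (HasCardinality (Section X (suc n))) (constant n (≤-pred n₁<n)) (card n) })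

theorem1p1 : ∀ {ℓ} → ExcludedMiddle ℓ →
    (k l : ℕ) → 2 ≤ k → 2 ≤ l →
    (X : Pred (Coloring k l) ℓ) → IsIdeal X →
    (∃ λ (c : ℕ) → ∃ λ (n₀ : ℕ) →
    (n : ℕ) → .{{_ : NonZero n}} → n₀ < n → HasCardinality (Section X n) c)
    ⊎
    ((n : ℕ) → .{{_ : NonZero n}} →
    ∃ λ (c : ℕ) → HasCardinality (Section X n) c × n + 2 ≤ c + k)
theorem1p1 {ℓ} em k l _ 2≤l X ideal =
  -- Excluded middle at level `ℓ` is brought down to `Set`, where the statements about `f` live.
  dichotomy (map′ lower lift (em {Lift ℓ _})) ideal q (λ n → proj₁ (finiteness n)) (λ n → proj₂ (finiteness n))
  where
  q : Fin l
  -- Some color is needed as the default value in `extend`.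
  q = Fin.fromℕ< (≤-trans (s≤s z≤n) 2≤l)
  finiteness : ∀ n → ∃ λ c → HasCardinality (Section X (suc n)) c
  finiteness n = section-finite em q X (suc n)
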